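{- Let $P$ be a countable meet-continuous dcpo such that, for every $r\in P$, every nonempty subset of the principal ideal $\mathord{\downarrow}r$ has a supremum in $\mathord{\downarrow}r$. Suppose that for all $x,y\in P$ there is a finite set $F_{x,y}\subseteq P$, possibly empty, such that \[ \mathord{\uparrow}x\cap\mathord{\uparrow}y=\mathord{\uparrow}F_{x,y}. \] Then the Scott space $\Sigma P$ is sober.
   Context: All posets and directed sets are nonempty; countable sets may be finite. A subset $D$ of a poset is directed if any two of its elements have a common upper bound in $D$. A dcpo is a poset in which every directed subset has a supremum. Write $\mathord{\downarrow}x=\{y:y\le x\}$, $\mathord{\uparrow}x=\{y:x\le y\}$, $\mathord{\downarrow}A=\bigcup_{a\in A}\mathord{\downarrow}a$ and $\mathord{\uparrow}A=\bigcup_{a\in A}\mathord{\uparrow}a$. A supremum in $\mathord{\downarrow}r$ means a least upper bound computed in $\mathord{\downarrow}r$ with its induced order. For a dcpo $P$, an upper set $U\subseteq P$ is Scott open if for every directed $D\subseteq P$, $\bigvee D\in U$ implies $D\cap U\neq\emptyset$; the Scott open sets form the Scott topology $\sigma(P)$, and $\Sigma P=(P,\sigma(P))$ is the Scott space. A dcpo $P$ is meet-continuous if for every $x\in P$ and every directed $D\subseteq P$, $x\le\bigvee D$ implies $x\in\operatorname{cl}_{\sigma(P)}(\mathord{\downarrow}x\cap\mathord{\downarrow}D)$, where $\operatorname{cl}_{\sigma(P)}$ is closure in the Scott topology. A nonempty Scott-closed set $A$ is irreducible if any two open sets meeting $A$ have an intersection meeting $A$. $\Sigma P$ is sober if each irreducible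 closed set $A$ equals $\mathord{\downarrow}a$ for a unique $a\in P$. -}

module Defs where

open import Level using (Level; _⊔_; suc)
open import Data.List.Base using (List)
import Data.List.Membership.Setoid as ListMembership
open import Data.Nat.Base using (ℕ)
open import Data.Product.Base using (_×_; ∃; ∃-syntax)
open import Data.Product using (∃!)
open import Function.Bundles using (Injection)
open import Relation.Binary.Bundles using (Poset)
open import Relation.Binary.Definitions using (_Respects_)
open import Relation.Binary.PropositionalEquality.Properties using (setoid)
open import Relation.Unary using (Pred; _∈_; _⊆_; _≐_; _∩_; _≬_; ∁; Satisfiable)

module Scott {c ℓ₁ ℓ₂ : Level} (P : Poset c ℓ₁ ℓ₂) where

  open Poset P

  -- Nothing below requires a subset to respect _≈_: bounds and suprema depend
  -- only on the _≈_-saturation of a subset, and upper sets are saturated.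
  Subset : Set (suc (c ⊔ ℓ₁ ⊔ ℓ₂))
  Subset = Pred Carrier (c ⊔ ℓ₁ ⊔ ℓ₂)

  infix 9 ↓_ ↑_ ↓ˢ_ ↑ˢ_

  ↓_ ↑_ : Carrier → Pred Carrier ℓ₂
  (↓ x) y = y ≤ x
  (↑ x) y = x ≤ y

  ↓ˢ_ ↑ˢ_ : ∀ {a} → Pred Carrier a → Pred Carrier (c ⊔ a ⊔ ℓ₂)
  (↓ˢ A) y = ∃[ a ] a ∈ A × y ∈ ↓ a
  (↑ˢ A) y = ∃[ a ] a ∈ A × y ∈ ↑ a

  IsUpperBound : ∀ {a} → Pred Carrier a → Carrier → Set (c ⊔ a ⊔ ℓ₂)
  IsUpperBound S u = ∀ {y} → y ∈ S → y ≤ u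

  record IsSupremum {a} (S : Pred Carrier a) (s : Carrier) : Set (c ⊔ a ⊔ ℓ₂) where
    field
      upper : IsUpperBound S s
      least : ∀ {u} → IsUpperBound S u → s ≤ u

  -- Least among the upper bounds of S that lie in X.
  record IsSupremumIn {a b} (X : Pred Carrier b) (S : Pred Carrier a) (s : Carrier)
         : Set (c ⊔ a ⊔ b ⊔ ℓ₂) where
    field
      member : s ∈ X
      upper  : IsUpperBound S s
      least  : ∀ {u} → u ∈ X → IsUpperBound S u → s ≤ u

  record IsDirected {a} (D : Pred Carrier a) : Set (c ⊔ a ⊔ ℓ₂) where
    field
      nonempty : Satisfiable D
      directed : ∀ {x y} → x ∈ D → y ∈ D → ∃[ z ] z ∈ D × x ≤ z × y ≤ z

  IsDcpo : Set (suc (c ⊔ ℓ₁ ⊔ ℓ₂))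
  IsDcpo = (D : Subset) → IsDirected D → ∃[ s ] IsSupremum D s

  record IsScottOpen (V : Subset) : Set (suc (c ⊔ ℓ₁ ⊔ ℓ₂)) where
    field
      upperSet     : V Respects _≤_
      inaccessible : (D : Subset) → IsDirected D →
                     ∀ {s} → IsSupremum D s → s ∈ V → D ≬ V

  IsScottClosed : Subset → Set (suc (c ⊔ ℓ₁ ⊔ ℓ₂))
  IsScottClosed A = IsScottOpen (∁ A)

  cl : ∀ {a} → Pred Carrier a → Pred Carrier (a ⊔ suc (c ⊔ ℓ₁ ⊔ ℓ₂))
  cl A x = (C : Subset) → IsScottClosed C → A ⊆ C → x ∈ C

  IsMeetContinuous : Set (suc (c ⊔ ℓ₁ ⊔ ℓ₂))
  IsMeetContinuous = (x : Carrier) (D : Subset) → IsDirected D →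
                     ∀ {s} → IsSupremum D s → x ≤ s → x ∈ cl (↓ x ∩ ↓ˢ D)

  record IsIrreducible (A : Subset) : Set (suc (c ⊔ ℓ₁ ⊔ ℓ₂)) where
    field
      closed   : IsScottClosed A
      nonempty : Satisfiable A
      meets    : (V W : Subset) → IsScottOpen V → IsScottOpen W →
                 V ≬ A → W ≬ A → (V ∩ W) ≬ A

  IsSober : Set (suc (c ⊔ ℓ₁ ⊔ ℓ₂))
  IsSober = (A : Subset) → IsIrreducible A → ∃! _≈_ (λ a → A ≐ ↓ a)

  IsCountable : Set (c ⊔ ℓ₁)
  IsCountable = Injection Eq.setoid (setoid ℕ)

  PrincipalIdealsHaveSuprema : Set (suc (c ⊔ ℓ₁ ⊔ ℓ₂))
  PrincipalIdealsHaveSuprema =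
    (r : Carrier) (S : Subset) → Satisfiable S → S ⊆ ↓ r →
    ∃[ s ] IsSupremumIn (↓ r) S s

  open ListMembership Eq.setoid using () renaming (_∈_ to _∈ˡ_)

  -- A finite subset, possibly empty, is the set of entries of a list.
  UpperIntersectionsFinite : Set (c ⊔ ℓ₁ ⊔ ℓ₂)
  UpperIntersectionsFinite =
    (x y : Carrier) → ∃ λ (F : List Carrier) → (↑ x ∩ ↑ y) ≐ ↑ˢ (_∈ˡ F)

{-# OPTIONS --safe #-}
module Submission where

-- It suffices that an irreducible closed set A is directed. For each y the set
-- S y = { u | u and y have an upper bound in A } is Scott closed: by finiteness of F
-- and a pigeonhole argument, an enumeration of a directed D ⊆ S y can be followed by
-- an ascending sequence in A above y. Suppose x ∉ S y. Order the pairs (a , b) with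
-- a ∉ S b componentwise, and descend from (x , y) through a sequence (aₙ , bₙ) generic
-- for countably many predicates, in the sense of forcing. The upper sets V and W
-- generated by the aₙ and by the bₙ meet A but V ∩ W does not, contradicting
-- irreducibility once they are Scott open. For V: let D be directed with supremum r
-- above some aₘ, but miss V. Meet-continuity shrinks conditions below elements of D,
-- so genericity yields, for each e ∈ D and k, some n and u ≤ r with e, aₙ ≤ u but
-- aₖ ≰ u. A diagonal choice then gives elements tₖ ≤ aₖ, occurring in conditions below
-- the k-th one, whose supremum s in ↓ r lies below every chosen u, so s ∉ V. But the
-- tₖ show that no aₙ forces s out of V, so by genericity s ∈ V.

open import Defs
open import Axiom.ExcludedMiddle using (ExcludedMiddle)
open import Relation.Binary.Bundles using (Poset)
open import Level using (_⊔_; Lift; lift)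
open import Data.Empty using (⊥; ⊥-elim)
open import Data.List.Base using (List; []; _∷_)
open import Data.List.Relation.Unary.Any using (here; there)
import Data.List.Membership.Setoid as ListMembership
open import Data.Nat.Base as ℕ using (ℕ; zero; suc; z≤n; s≤s)
import Data.Nat.Properties as ℕ
open import Data.Product.Base using (_×_; _,_; ∃; ∃-syntax; Σ-syntax; proj₁; proj₂)
open import Data.Sum.Base using (_⊎_; inj₁; inj₂)
open import Function.Base using (_∘_; flip; id; case_of_)
open import Function.Bundles using (Injection)
open import Relation.Binary.Core using (Rel)
open import Relation.Binary.Definitions using (Reflexive; Transitive)
open import Relation.Binary.PropositionalEquality.Core using (_≡_; refl; subst; sym; cong)
open import Relation.Nullary using (¬_; yes; no)
open import Relation.Nullary.Decidable using (decidable-stable)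
open import Relation.Unary using (Pred; _∈_; _∉_; _⊆_; _≐_; _∩_; _≬_; ∁)

-- Monotone sequences and dependent choice

stepwise⇒monotone : ∀ {a ℓ} {A : Set a} {R : Rel A ℓ} → Reflexive R → Transitive R →
                    {f : ℕ → A} → (∀ n → R (f n) (f (suc n))) →
                    ∀ {m n} → m ℕ.≤ n → R (f m) (f n)
stepwise⇒monotone {R = R} R-refl R-trans {f} step = go _
  where
  go : ∀ {m} n → m ℕ.≤ n → R (f m) (f n)
  go zero    z≤n = R-refl
  go (suc n) m≤n with ℕ.m≤n⇒m<n∨m≡n m≤n
  ... | inj₁ (s≤s m≤n′) = R-trans (go n m≤n′) (step n)
  ... | inj₂ refl       = R-refl

dependentChoice : ∀ {a ℓ} {A : Set a} {R : ℕ → Rel A ℓ} →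
                  (∀ n x → ∃[ y ] R n x y) → (x : A) →
                  ∃[ f ] f 0 ≡ x × (∀ n → R n (f n) (f (suc n)))
dependentChoice {A = A} next x = f , refl , λ n → proj₂ (next n (f n))
  where
  f : ℕ → A
  f zero    = x
  f (suc n) = proj₁ (next n (f n))

-- Dense open sets of conditions and generic sequences

module Forcing {q ℓ} {Q : Set q} (_⊑_ : Rel Q ℓ)
               (⊑-refl : Reflexive _⊑_) (⊑-trans : Transitive _⊑_) where

  Hereditary : ∀ {a} → Pred Q a → Set _
  Hereditary R = ∀ {p q} → q ⊑ p → R p → R q

  record IsDenseOpen {a} (R : Pred Q a) : Set (q ⊔ ℓ ⊔ a) where
    field
      dense      : ∀ p → ∃[ q ] q ⊑ p × R q
      hereditary : Hereditary R

  open IsDenseOpen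

  ∩-isDenseOpen : ∀ {a b} {R : Pred Q a} {S : Pred Q b} →
                  IsDenseOpen R → IsDenseOpen S → IsDenseOpen (R ∩ S)
  ∩-isDenseOpen R S .dense p =
    let q , q⊑p , Rq = R .dense p
        r , r⊑q , Sr = S .dense q
    in r , ⊑-trans r⊑q q⊑p , R .hereditary r⊑q Rq , Sr
  ∩-isDenseOpen R S .hereditary q⊑p (Rp , Sp) = R .hereditary q⊑p Rp , S .hereditary q⊑p Sp

  bounded-⋂-isDenseOpen : ∀ {a} {R : ℕ → Pred Q a} → (∀ i → IsDenseOpen (R i)) →
                          ∀ n → IsDenseOpen (λ p → ∀ {i} → i ℕ.< n → R i p)
  bounded-⋂-isDenseOpen R n .hereditary q⊑p Rp i<n = R _ .hereditary q⊑p (Rp i<n)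
  bounded-⋂-isDenseOpen R zero .dense p = p , ⊑-refl , λ ()
  bounded-⋂-isDenseOpen {R = R′} R (suc n) .dense p =
    let q , q⊑p , Rq = bounded-⋂-isDenseOpen R n .dense p
        r , r⊑q , Rr = R n .dense q
    in r , ⊑-trans r⊑q q⊑p , λ i<1+n → case ℕ.m≤n⇒m<n∨m≡n (ℕ.≤-pred i<1+n) of λ where
         (inj₁ i<n) → R _ .hereditary r⊑q (Rq i<n)
         (inj₂ i≡n) → subst (λ i → R′ i r) (sym i≡n) Rr

  rasiowaSikorski : ∀ {a} {R : ℕ → Pred Q a} → (∀ n → IsDenseOpen (R n)) → ∀ p →
                    ∃[ g ] g 0 ≡ p × (∀ n → g (suc n) ⊑ g n × R n (g (suc n)))
  rasiowaSikorski R = dependentChoice (λ n p → R n .dense p)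

  -- In forcing terms, `p` forces `E` or forces its negation.
  Decided : ∀ {a} → Pred Q a → Pred Q (q ⊔ ℓ ⊔ a)
  Decided E p = (∀ {q} → q ⊑ p → E q) ⊎ (∀ {q} → q ⊑ p → ¬ E q)

  Decided-resp-≐ : ∀ {a} {E F : Pred Q a} → E ≐ F → Decided E ⊆ Decided F
  Decided-resp-≐ (E⊆F , F⊆E) (inj₁ e) = inj₁ λ q⊑p → E⊆F (e q⊑p)
  Decided-resp-≐ (E⊆F , F⊆E) (inj₂ e) = inj₂ λ q⊑p Fq → e q⊑p (F⊆E Fq)

  module _ (em : ∀ {a} → ExcludedMiddle a) where

    -- If some extension of `p` lies in `E`, heredity makes that extension force `E`; otherwise `p`
    -- itself forces the negation.
    Decided-isDenseOpen : ∀ {a} {E : Pred Q a} → Hereditary E → IsDenseOpen (Decided E)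
    Decided-isDenseOpen {E = E} E-hered .dense p with em {P = ∃[ q ] q ⊑ p × E q}
    ... | yes (q , q⊑p , Eq) = q , q⊑p , inj₁ λ r⊑q → E-hered r⊑q Eq
    ... | no ∄q              = p , ⊑-refl , inj₂ λ q⊑p Eq → ∄q (_ , q⊑p , Eq)
    Decided-isDenseOpen E-hered .hereditary q⊑p (inj₁ e) = inj₁ λ r⊑q → e (⊑-trans r⊑q q⊑p)
    Decided-isDenseOpen E-hered .hereditary q⊑p (inj₂ e) = inj₂ λ r⊑q → e (⊑-trans r⊑q q⊑p)

-- Ascending sequences and Scott-closed sets

module _ (em : ∀ {a} → ExcludedMiddle a) {c ℓ₁ ℓ₂} (P : Poset c ℓ₁ ℓ₂) where

  open Poset P renaming (refl to ≤-refl; trans to ≤-trans)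
  open Scott P
  open IsSupremum
  open IsDirected
  open IsScottOpen
  open IsIrreducible
  open ListMembership Eq.setoid using () renaming (_∈_ to _∈ˡ_)

  private
    stable : ∀ {a} {X : Set a} → ¬ ¬ X → X
    stable = decidable-stable em

  Range : (ℕ → Carrier) → Subset
  Range f y = Lift (ℓ₁ ⊔ ℓ₂) (∃[ n ] y ≡ f n)

  ascending⇒directed : {f : ℕ → Carrier} → (∀ n → f n ≤ f (suc n)) → IsDirected (Range f)
  ascending⇒directed {f} asc .nonempty = f 0 , lift (0 , refl)
  ascending⇒directed {f} asc .directed (lift (m , refl)) (lift (n , refl)) =
    f (m ℕ.⊔ n) , lift (m ℕ.⊔ n , refl) ,
    mono (ℕ.m≤m⊔n m n) , mono (ℕ.m≤n⊔m m n)
    where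
    mono : ∀ {i j} → i ℕ.≤ j → f i ≤ f j
    mono = stepwise⇒monotone {R = _≤_} ≤-refl ≤-trans asc

  closed⇒lower : ∀ {A} → IsScottClosed A → ∀ {x y} → y ≤ x → x ∈ A → y ∈ A
  closed⇒lower A-closed y≤x x∈A = stable λ y∉A → A-closed .upperSet y≤x y∉A x∈A

  closed⇒sup∈ : ∀ {A} → IsScottClosed A → (D : Subset) → IsDirected D → D ⊆ A →
                ∀ {s} → IsSupremum D s → s ∈ A
  closed⇒sup∈ A-closed D D-dir D⊆A s-sup = stable λ s∉A →
    let d , d∈D , d∉A = A-closed .inaccessible D D-dir s-sup s∉A in d∉A (D⊆A d∈D)

  -- Countability and closedness of the joinable sets

  module _ (countable : IsCountable) where

    open Injection countable using (injective) renaming (to to code)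

    enumeration : Carrier → ∃[ enum ] (∀ x → ∃[ n ] enum n ≈ x)
    enumeration x₀ = enum , λ x → code x , enum∘code x
      where
      enum : ℕ → Carrier
      enum n with em {P = ∃[ x ] code x ≡ n}
      ... | yes (x , _) = x
      -- Numbers that code no element get the default value `x₀`.
      ... | no _        = x₀
      enum∘code : ∀ x → enum (code x) ≈ x
      enum∘code x with em {P = ∃[ y ] code y ≡ code x}
      ... | yes (_ , eq) = injective eq
      ... | no ∄y        = ⊥-elim (∄y (x , refl))

    -- This is the set S y of the outline.
    JoinableIn : Subset → Carrier → Subset
    JoinableIn A y x = ∃[ e ] e ∈ A × x ≤ e × y ≤ e

    joinable-sym : ∀ {A x y} → x ∈ JoinableIn A y → y ∈ JoinableIn A x
    joinable-sym (e , e∈A , x≤e , y≤e) = e , e∈A , y≤e , x≤e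

    module _ (dcpo : IsDcpo) (finiteF : UpperIntersectionsFinite) where

      module _ {A : Subset} (A-closed : IsScottClosed A)
               (D : Subset) (D-dir : IsDirected D) where

        -- The finite-branching pigeonhole invariant: a good element can be raised
        -- above any element of D and stay good.
        Good : Subset
        Good a = ∀ {d} → d ∈ D → a ∈ JoinableIn A d

        -- Induction on `F`: a member that is not good is refuted at some element of `D`. Refutation
        -- persists upwards, so directedness merges all refutations into one `d′`.
        good-or-refuted : ∀ {d} → d ∈ D → (F : List Carrier) →
          (∃[ f ] f ∈ˡ F × f ∈ Good) ⊎
          (∃[ d′ ] d′ ∈ D × d ≤ d′ × (∀ {f} → f ∈ˡ F → f ∉ JoinableIn A d′))
        good-or-refuted d∈D [] = inj₂ (_ , d∈D , ≤-refl , λ ())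
        good-or-refuted d∈D (f ∷ F) with good-or-refuted d∈D F | em {P = f ∈ Good}
        ... | inj₁ (f′ , f′∈F , good) | _        = inj₁ (f′ , there f′∈F , good)
        ... | inj₂ _                  | yes good = inj₁ (f , here Eq.refl , good)
        ... | inj₂ (d₁ , d₁∈D , d≤d₁ , refutes) | no ¬good =
          let d₂ , d₂∈D , f∉ = stable λ ∄ → ¬good λ {d₂} d₂∈D → stable λ f∉ → ∄ (d₂ , d₂∈D , f∉)
              d′ , d′∈D , d₁≤d′ , d₂≤d′ = D-dir .directed d₁∈D d₂∈D
          in inj₂ (d′ , d′∈D , ≤-trans d≤d₁ d₁≤d′ , λ where
               (here g≈f) (e , e∈A , g≤e , d′≤e) →
                 f∉ (e , e∈A , ≤-trans (reflexive (Eq.sym g≈f)) g≤e , ≤-trans d₂≤d′ d′≤e)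
               (there g∈F) (e , e∈A , g≤e , d′≤e) →
                 refutes g∈F (e , e∈A , g≤e , ≤-trans d₁≤d′ d′≤e))

        -- Were all of `F` refuted at some `d′` above `d`, goodness of `a` at `d′` would give a
        -- point of `A` above `a` and `d′`, hence above a member of `F`, which is absurd.
        good-extend : ∀ {a d} → a ∈ Good → d ∈ D → ∃[ b ] b ∈ Good × a ≤ b × d ≤ b
        good-extend {a} {d} good d∈D with finiteF a d
        ... | F , ⊆↑F , ↑F⊆ with good-or-refuted d∈D F
        ...   | inj₁ (f , f∈F , f-good) =
          let a≤f , d≤f = ↑F⊆ (f , f∈F , ≤-refl) in f , f-good , a≤f , d≤f
        ...   | inj₂ (d′ , d′∈D , d≤d′ , refutes) =
          let e , e∈A , a≤e , d′≤e = good d′∈D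
              f , f∈F , f≤e = ⊆↑F (a≤e , ≤-trans d≤d′ d′≤e)
          in ⊥-elim (refutes f∈F (e , e∈A , f≤e , d′≤e))

        -- An ascending chain of good elements starts at `y` and absorbs at stage n the member of
        -- `D` with code n, if any. Its supremum lies in `A` and bounds both `y` and `D`.
        good⇒joinable-sup : ∀ {y s} → y ∈ Good → IsSupremum D s → s ∈ JoinableIn A y
        good⇒joinable-sup {y} y-good s-sup =
          t , closed⇒sup∈ A-closed (Range a) a-dir a⊆A t-sup ,
          s-sup .least d≤t , subst (_≤ t) a₀≡y (t-sup .upper (lift (0 , refl)))
          where
          next : ∀ n → (a : ∃ Good) → Σ[ b ∈ ∃ Good ]
                 (proj₁ a ≤ proj₁ b × (∀ {d} → d ∈ D → code d ≡ n → d ≤ proj₁ b))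
          next n (a , a-good) with em {P = ∃[ d ] d ∈ D × code d ≡ n}
          ... | no ∄d = (a , a-good) , ≤-refl , λ d∈D eq → ⊥-elim (∄d (_ , d∈D , eq))
          ... | yes (d , d∈D , refl) =
            let b , b-good , a≤b , d≤b = good-extend a-good d∈D
            in (b , b-good) , a≤b , λ _ eq → ≤-trans (reflexive (injective eq)) d≤b

          chain = dependentChoice next (y , y-good)
          a : ℕ → Carrier
          a n = proj₁ (proj₁ chain n)
          a₀≡y : a 0 ≡ y
          a₀≡y rewrite proj₁ (proj₂ chain) = refl
          a-step = proj₂ (proj₂ chain)
          a-dir : IsDirected (Range a)
          a-dir = ascending⇒directed (proj₁ ∘ a-step)
          t = proj₁ (dcpo (Range a) a-dir)
          t-sup = proj₂ (dcpo (Range a) a-dir)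
          a⊆A : Range a ⊆ A
          a⊆A (lift (n , refl)) =
            let d , d∈D = D-dir .nonempty
                e , e∈A , a≤e , _ = proj₂ (proj₁ chain n) d∈D
            in closed⇒lower A-closed a≤e e∈A
          d≤t : IsUpperBound D t
          d≤t {d} d∈D = ≤-trans (proj₂ (a-step (code d)) d∈D refl)
                                (t-sup .upper (lift (suc (code d) , refl)))

      joinable-closed : ∀ {A} → IsScottClosed A → ∀ y → IsScottClosed (JoinableIn A y)
      joinable-closed A-closed y .upperSet x≤x′ x∉ (e , e∈A , x′≤e , y≤e) =
        x∉ (e , e∈A , ≤-trans x≤x′ x′≤e , y≤e)
      joinable-closed {A} A-closed y .inaccessible D D-dir s-sup s∉ = stable λ D∌ →
        -- By symmetry, `D` inside `JoinableIn A y` means that `y` is good.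
        s∉ (good⇒joinable-sup A-closed D D-dir (λ d∈D → joinable-sym (D⊆ D∌ d∈D)) s-sup)
        where
        D⊆ : ¬ (D ≬ ∁ (JoinableIn A y)) → D ⊆ JoinableIn A y
        D⊆ D∌ d∈D = stable λ d∉ → D∌ (_ , d∈D , d∉)

  -- Openness of the upper set generated by one coordinate of a generic sequence

  module Coordinate
    (ideals : PrincipalIdealsHaveSuprema)
    {q ℓ} {Q : Set q} (_⊑_ : Rel Q ℓ) (⊑-refl : Reflexive _⊑_) (⊑-trans : Transitive _⊑_)
    (π : Q → Carrier) (π-mono : ∀ {p q} → q ⊑ p → π q ≤ π p)
    where

    open Forcing _⊑_ ⊑-refl ⊑-trans
    open IsSupremumIn

    Below : Carrier → Pred Q ℓ₂
    Below z p = π p ≤ z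

    -- For `z` and `π p` below `r` this says that `v` is not below the join of `z` and `π p`
    -- computed in `↓ r`.
    Separates : (r z v : Carrier) → Pred Q (c ⊔ ℓ₂)
    Separates r z v p = ∃[ u ] u ≤ r × z ≤ u × π p ≤ u × ¬ v ≤ u

    below-hereditary : ∀ {z} → Hereditary (Below z)
    below-hereditary q⊑p p≤z = ≤-trans (π-mono q⊑p) p≤z

    separates-hereditary : ∀ {r z v} → Hereditary (Separates r z v)
    separates-hereditary q⊑p (u , u≤r , z≤u , p≤u , v≰u) =
      u , u≤r , z≤u , ≤-trans (π-mono q⊑p) p≤u , v≰u

    below-mono : ∀ {z z′} → z ≤ z′ → Below z ⊆ Below z′
    below-mono z≤z′ p≤z = ≤-trans p≤z z≤z′

    separates-mono : ∀ {r r′ z z′ v v′} → r ≤ r′ → z′ ≤ z → v ≤ v′ →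
                     Separates r z v ⊆ Separates r′ z′ v′
    separates-mono r≤r′ z′≤z v≤v′ (u , u≤r , z≤u , p≤u , v≰u) =
      u , ≤-trans u≤r r≤r′ , ≤-trans z′≤z z≤u , p≤u , λ v′≤u → v≰u (≤-trans v≤v′ v′≤u)

    module _ (enum : ℕ → Carrier) (enum-surjective : ∀ x → ∃[ n ] enum n ≈ x) where

      -- A common bound on three indices reaches every triple without coding triples as numbers.
      DecidesUpTo : ℕ → Pred Q _
      DecidesUpTo n p = ∀ {i} → i ℕ.< n → ∀ {j} → j ℕ.< n → ∀ {k} → k ℕ.< n →
        (Decided (Below (enum j)) ∩ Decided (Separates (enum i) (enum j) (enum k))) p

      decidesUpTo-isDenseOpen : ∀ n → IsDenseOpen (DecidesUpTo n)
      decidesUpTo-isDenseOpen n =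
        bounded-⋂-isDenseOpen (λ i → bounded-⋂-isDenseOpen (λ j → bounded-⋂-isDenseOpen (λ k →
          ∩-isDenseOpen (Decided-isDenseOpen em below-hereditary)
                        (Decided-isDenseOpen em separates-hereditary)) n) n) n

      module _ {g : ℕ → Q} (decides : ∀ n → DecidesUpTo n (g (suc n))) where

        decideBelow : ∀ z → ∃[ n ] Decided (Below z) (g n)
        decideBelow z =
          let i , i≈z = enum-surjective z
          in suc (suc i) ,
             Decided-resp-≐ (below-mono (reflexive i≈z) , below-mono (reflexive (Eq.sym i≈z)))
               -- Only the middle index matters for `Below`; 0 fills the other two.
               (proj₁ (decides (suc i) {0} (s≤s z≤n) ℕ.≤-refl {0} (s≤s z≤n)))

        decideSeparates : ∀ r z v → ∃[ n ] Decided (Separates r z v) (g n)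
        decideSeparates r z v =
          let i , i≈r = enum-surjective r
              j , j≈z = enum-surjective z
              k , k≈v = enum-surjective v
              n = i ℕ.⊔ (j ℕ.⊔ k)
          in suc (suc n) ,
             Decided-resp-≐
               ( separates-mono (reflexive i≈r) (reflexive (Eq.sym j≈z)) (reflexive k≈v)
               , separates-mono (reflexive (Eq.sym i≈r)) (reflexive j≈z) (reflexive (Eq.sym k≈v)))
               (proj₂ (decides (suc n)
                 (s≤s (ℕ.m≤m⊔n i (j ℕ.⊔ k)))
                 (s≤s (ℕ.≤-trans (ℕ.m≤m⊔n j k) (ℕ.m≤n⊔m i (j ℕ.⊔ k))))
                 (s≤s (ℕ.≤-trans (ℕ.m≤n⊔m j k) (ℕ.m≤n⊔m i (j ℕ.⊔ k))))))

    Shrinkable : Set _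
    Shrinkable = ∀ p (D : Subset) → IsDirected D → ∀ {s} → IsSupremum D s → π p ≤ s →
                 ∃[ d ] d ∈ D × ∃[ q ] q ⊑ p × π q ≤ d

    module _
      (shrink : Shrinkable)
      (g : ℕ → Q) (descending : ∀ n → g (suc n) ⊑ g n)
      (decideBelow : ∀ z → ∃[ n ] Decided (Below z) (g n))
      (decideSeparates : ∀ r z v → ∃[ n ] Decided (Separates r z v) (g n))
      where

      Generated : Subset
      Generated = ↑ˢ Range (π ∘ g)

      g-mono : ∀ {m n} → m ℕ.≤ n → g n ⊑ g m
      g-mono = stepwise⇒monotone {R = flip _⊑_} ⊑-refl (flip ⊑-trans) descending

      -- The assumptions are contradictory: D is a counterexample to the openness of
      -- Generated.
      module _ (D : Subset) (D-dir : IsDirected D) {r} (r-sup : IsSupremum D r)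
               (D∌ : ¬ (D ≬ Generated)) (m : ℕ) (gm≤r : π (g m) ≤ r) where

        -- Taking the maximum with `m` keeps the coordinate below `r`, as shrinking requires.
        shrink-below : ∀ n → ∃[ d ] d ∈ D × ∃[ q ] q ⊑ g n × π q ≤ d
        shrink-below n =
          let d , d∈D , q , q⊑ , q≤d =
                shrink (g (n ℕ.⊔ m)) D D-dir r-sup (≤-trans (π-mono (g-mono (ℕ.m≤n⊔m n m))) gm≤r)
          in d , d∈D , q , ⊑-trans q⊑ (g-mono (ℕ.m≤m⊔n n m)) , q≤d

        -- No `g n` forces non-separation: shrink it below an element of `D` and pass to `e` in `D`
        -- above `z` as well. Then `e` itself separates, since `e` misses `Generated` and so is not
        -- above `π (g k)`.
        separation : ∀ {z} → z ∈ D → ∀ k → ∃[ n ] Separates r z (π (g k)) (g n)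
        separation {z} z∈D k with decideSeparates r z (π (g k))
        ... | n , inj₁ sep = n , sep ⊑-refl
        ... | n , inj₂ ¬sep =
          let d , d∈D , q , q⊑ , q≤d = shrink-below n
              e , e∈D , d≤e , z≤e = D-dir .directed d∈D z∈D
          in ⊥-elim (¬sep q⊑ (e , r-sup .upper e∈D , z≤e , ≤-trans q≤d d≤e ,
                      λ gk≤e → D∌ (e , e∈D , π (g k) , lift (k , refl) , gk≤e)))

        State : Set _
        State = ∃ D × ℕ

        -- The coordinate of `condition` is the diagonal term tₖ; `separator` is chosen to bound all
        -- terms, earlier and later, without being above `π (g k)`.
        record Step (k : ℕ) (σ τ : State) : Set (c ⊔ ℓ₂ ⊔ q ⊔ ℓ) where
          field
            condition  : Q
            separator  : Carrier
            increasing : proj₁ (proj₁ σ) ≤ proj₁ (proj₁ τ)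
            index-mono : proj₂ σ ℕ.≤ proj₂ τ
            k≤index    : k ℕ.≤ proj₂ τ
            refines    : condition ⊑ g (proj₂ τ)
            inD        : π condition ≤ proj₁ (proj₁ τ)
            sep≤r      : separator ≤ r
            e≤sep      : proj₁ (proj₁ σ) ≤ separator
            g≤sep      : π (g (proj₂ τ)) ≤ separator
            gk≰sep     : ¬ π (g k) ≤ separator

        step : ∀ k σ → ∃[ τ ] Step k σ τ
        step k ((e , e∈D) , j) =
          let n , u , u≤r , e≤u , gn≤u , gk≰u = separation e∈D k
              -- At least `n`, so that `u` bounds `π (g j′)`; at least `j`, so that indices ascend;
              -- at least `k`, so that the new condition refines `g k`.
              j′ = n ℕ.⊔ (j ℕ.⊔ k)
              d , d∈D , q , q⊑ , q≤d = shrink-below j′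
              e′ , e′∈D , e≤e′ , d≤e′ = D-dir .directed e∈D d∈D
          in ((e′ , e′∈D) , j′) , record
            { condition  = q
            ; separator  = u
            ; increasing = e≤e′
            ; index-mono = ℕ.≤-trans (ℕ.m≤m⊔n j k) (ℕ.m≤n⊔m n (j ℕ.⊔ k))
            ; k≤index    = ℕ.≤-trans (ℕ.m≤n⊔m j k) (ℕ.m≤n⊔m n (j ℕ.⊔ k))
            ; refines    = q⊑
            ; inD        = ≤-trans q≤d d≤e′
            ; sep≤r      = u≤r
            ; e≤sep      = e≤u
            ; g≤sep      = ≤-trans (π-mono (g-mono (ℕ.m≤m⊔n n (j ℕ.⊔ k)))) gn≤u
            ; gk≰sep     = gk≰u
            }

        unreached-directed⇒⊥ : ⊥
        unreached-directed⇒⊥ = refute (decideBelow s)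
          where
          run = dependentChoice step (D-dir .nonempty , 0)
          e : ℕ → Carrier
          e k = proj₁ (proj₁ (proj₁ run k))
          j : ℕ → ℕ
          j k = proj₂ (proj₁ run k)
          module S (k : ℕ) = Step (proj₂ (proj₂ run) k)
          t : ℕ → Carrier
          t k = π (S.condition k)
          e-mono : ∀ {k l} → k ℕ.≤ l → e k ≤ e l
          e-mono = stepwise⇒monotone {R = _≤_} ≤-refl ≤-trans S.increasing
          j-mono : ∀ {k l} → k ℕ.≤ l → j k ℕ.≤ j l
          j-mono = stepwise⇒monotone {R = ℕ._≤_} ℕ.≤-refl ℕ.≤-trans S.index-mono
          t≤r : Range t ⊆ ↓ r
          t≤r (lift (k , refl)) =
            ≤-trans (S.inD k) (r-sup .upper (proj₂ (proj₁ (proj₁ run (suc k)))))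
          t≤sep : ∀ k → IsUpperBound (Range t) (S.separator k)
          -- Earlier t lie below the current element of D, later ones below the current
          -- member of the generic sequence.
          t≤sep k (lift (l , refl)) with ℕ.<-≤-connex l k
          ... | inj₁ l<k = ≤-trans (S.inD l) (≤-trans (e-mono l<k) (S.e≤sep k))
          ... | inj₂ k≤l =
            ≤-trans (π-mono (⊑-trans (S.refines l) (g-mono (j-mono (s≤s k≤l))))) (S.g≤sep k)
          supremum = ideals r (Range t) (t 0 , lift (0 , refl)) t≤r
          s = proj₁ supremum
          s-sup = proj₂ supremum
          -- Step `n` of the run refutes both answers of `g n`: its separator is above `s` but not
          -- above `π (g n)`, and its condition extends `g n` with coordinate below `s`.
          refute : ¬ (∃[ n ] Decided (Below s) (g n))
          refute (n , inj₁ below) =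
            S.gk≰sep n (≤-trans (below ⊑-refl) (s-sup .least (S.sep≤r n) (t≤sep n)))
          refute (n , inj₂ ¬below) =
            ¬below (⊑-trans (S.refines n) (g-mono (S.k≤index n))) (s-sup .upper (lift (n , refl)))

      generated-open : IsScottOpen Generated
      generated-open .upperSet x≤y (a , a∈ , a≤x) = a , a∈ , ≤-trans a≤x x≤y
      generated-open .inaccessible D D-dir s-sup (_ , lift (m , refl) , gm≤s) =
        stable λ D∌ → unreached-directed⇒⊥ D D-dir s-sup D∌ m gm≤s

  -- Pairs without an upper bound in `A`, and sobriety

  module _ (x₀ : Carrier) (countable : IsCountable) (dcpo : IsDcpo)
           (meetContinuous : IsMeetContinuous) (ideals : PrincipalIdealsHaveSuprema)
           (finiteF : UpperIntersectionsFinite) where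

    module _ {A : Subset} (A-closed : IsScottClosed A) where

      Joinable : Carrier → Subset
      Joinable = JoinableIn countable A

      Condition : Set _
      Condition = ∃[ a ] ∃[ b ] a ∉ Joinable b

      left right : Condition → Carrier
      left  (a , b , _) = a
      right (a , b , _) = b

      record _⊑_ (p q : Condition) : Set ℓ₂ where
        constructor _,_
        field
          left≤  : left p ≤ left q
          right≤ : right p ≤ right q

      open _⊑_

      ⊑-refl : Reflexive _⊑_
      ⊑-refl = ≤-refl , ≤-refl

      ⊑-trans : Transitive _⊑_
      ⊑-trans (a≤ , b≤) (a≤′ , b≤′) = ≤-trans a≤ a≤′ , ≤-trans b≤ b≤′

      open Forcing _⊑_ ⊑-refl ⊑-trans

      module Left  = Coordinate ideals _⊑_ ⊑-refl ⊑-trans left left≤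
      module Right = Coordinate ideals _⊑_ ⊑-refl ⊑-trans right right≤

      -- Otherwise the Scott-closed set `Joinable b` would contain `↓ a ∩ ↓ˢ D`, and hence `a` by
      -- meet-continuity.
      shrink : ∀ {a b} → a ∉ Joinable b → (D : Subset) → IsDirected D →
               ∀ {s} → IsSupremum D s → a ≤ s →
               ∃[ d ] d ∈ D × ∃[ a′ ] a′ ≤ a × a′ ≤ d × a′ ∉ Joinable b
      shrink {a} {b} a∉ D D-dir s-sup a≤s = stable λ ∄ →
        a∉ (meetContinuous a D D-dir s-sup a≤s (Joinable b)
              (joinable-closed countable dcpo finiteF A-closed b)
              λ (a′≤a , d , d∈D , a′≤d) → stable λ a′∉ → ∄ (d , d∈D , _ , a′≤a , a′≤d , a′∉))

      left-shrinkable : Left.Shrinkable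
      left-shrinkable (a , b , a∉) D D-dir s-sup a≤s =
        let d , d∈D , a′ , a′≤a , a′≤d , a′∉ = shrink a∉ D D-dir s-sup a≤s
        in d , d∈D , (a′ , b , a′∉) , (a′≤a , ≤-refl) , a′≤d

      right-shrinkable : Right.Shrinkable
      right-shrinkable (a , b , a∉) D D-dir s-sup b≤s =
        let d , d∈D , b′ , b′≤b , b′≤d , b′∉ =
              shrink (a∉ ∘ joinable-sym countable) D D-dir s-sup b≤s
        in d , d∈D , (a , b′ , b′∉ ∘ joinable-sym countable) , (≤-refl , b′≤b) , b′≤d

      separating-opens : ∀ {x y} → x ∉ Joinable y →
        ∃[ V ] ∃[ W ] IsScottOpen V × IsScottOpen W × x ∈ V × y ∈ W × ¬ (V ∩ W) ≬ A
      separating-opens {x} {y} x∉ =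
        _ , _ ,
        Left.generated-open left-shrinkable g g-step
          (Left.decideBelow enum enum-surj (proj₁ ∘ decides))
          (Left.decideSeparates enum enum-surj (proj₁ ∘ decides)) ,
        Right.generated-open right-shrinkable g g-step
          (Right.decideBelow enum enum-surj (proj₂ ∘ decides))
          (Right.decideSeparates enum enum-surj (proj₂ ∘ decides)) ,
        (left (g 0) , lift (0 , refl) , reflexive (Eq.reflexive (cong left g₀≡))) ,
        (right (g 0) , lift (0 , refl) , reflexive (Eq.reflexive (cong right g₀≡))) ,
        -- A point of `A` in both sets would bound both coordinates of the single condition
        -- `g (m ℕ.⊔ n)`.
        λ where (z , ((_ , lift (m , refl) , a≤z) , (_ , lift (n , refl) , b≤z)) , z∈A) →
                  proj₂ (proj₂ (g (m ℕ.⊔ n)))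
                    (z , z∈A , ≤-trans (left≤ (g-mono (ℕ.m≤m⊔n m n))) a≤z
                             , ≤-trans (right≤ (g-mono (ℕ.m≤n⊔m m n))) b≤z)
        where
        enum = proj₁ (enumeration countable x₀)
        enum-surj = proj₂ (enumeration countable x₀)
        generic = rasiowaSikorski (λ n → ∩-isDenseOpen (Left.decidesUpTo-isDenseOpen enum enum-surj n)
                                                       (Right.decidesUpTo-isDenseOpen enum enum-surj n))
                                  (x , y , x∉)
        g = proj₁ generic
        g₀≡ = proj₁ (proj₂ generic)
        g-step = proj₁ ∘ proj₂ (proj₂ generic)
        decides = proj₂ ∘ proj₂ (proj₂ generic)
        g-mono : ∀ {m n} → m ℕ.≤ n → g n ⊑ g m
        g-mono = stepwise⇒monotone {R = flip _⊑_} ⊑-refl (flip ⊑-trans) g-step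

    irreducible⇒directed : ∀ {A} → IsIrreducible A → IsDirected A
    irreducible⇒directed A-irr .nonempty = A-irr .nonempty
    irreducible⇒directed {A} A-irr .directed {x} {y} x∈A y∈A = stable λ x∉ →
      let V , W , V-open , W-open , x∈V , y∈W , disjoint = separating-opens (A-irr .closed) x∉
      in disjoint (A-irr .meets V W V-open W-open (x , x∈V , x∈A) (y , y∈W , y∈A))

    -- A directed Scott-closed set contains its supremum, so it is the principal ideal of that
    -- supremum.
    sober : IsSober
    sober A A-irr = a , (a-sup .upper , λ x≤a → closed⇒lower (A-irr .closed) x≤a a∈A) , unique
      where
      A-dir = irreducible⇒directed A-irr
      a = proj₁ (dcpo A A-dir)
      a-sup = proj₂ (dcpo A A-dir)
      a∈A : a ∈ A
      a∈A = closed⇒sup∈ (A-irr .closed) A A-dir id a-sup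
      unique : ∀ {b} → A ≐ ↓ b → a ≈ b
      unique (A⊆↓b , ↓b⊆A) = antisym (A⊆↓b a∈A) (a-sup .upper (↓b⊆A ≤-refl))

corollary5p6 : (∀ {a} → ExcludedMiddle a) →
    ∀ {c ℓ₁ ℓ₂} (P : Poset c ℓ₁ ℓ₂) → (let open Scott P) →
    Poset.Carrier P →
    IsCountable →
    IsDcpo →
    IsMeetContinuous →
    PrincipalIdealsHaveSuprema →
    UpperIntersectionsFinite →
    IsSober
corollary5p6 em P = sober em P
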